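{- Given two curves $\sigma=(v_1,\dots,v_{m'})$ and $\tau=(w_1,\dots,w_{m''})$ in $\mathbb{R}^d$ and a parameter $k\in\mathbb{N}$, the following algorithm returns exactly $d_{k\text{ - }DTW}(\sigma,\tau)$ and runs in $O(m'm''z)$ time, where $z$ is the number of distinct distances $\|v_i-w_j\|$ between pairs of vertices of $\sigma$ and $\tau$. Algorithm: set $D[i,j]=\|v_i-w_j\|$ for all $(i,j)\in[m']\times[m'']$; let $E[1]>\dots>E[z]>E[z+1]=0$ be the $z$ distinct entries of $D$ together with $0$, in decreasing order; set mincost $=\infty$; for each $l\in\{1,\dots,z+1\}$, let $D'[i,j]=\max\{D[i,j]-E[l],0\}$ for all $(i,j)$ and update mincost $\leftarrow\min\{\text{mincost},\ \mathrm{DTW}(D')+k\cdot E[l]\}$; return mincost.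
   Context: A traversal of $\sigma$ and $\tau$ is a sequence of index pairs starting with $(1,1)$, ending with $(m',m'')$, where each $(i,j)$ is followed only by $(i+1,j)$, $(i,j+1)$ or $(i+1,j+1)$. For a matrix $D'\in\mathbb{R}^{m'\times m''}$, $\mathrm{DTW}(D')=\min_T\sum_{(i,j)\in T}D'[i,j]$ over all traversals $T$ (computable in $O(m'm'')$ time by dynamic programming). For a traversal $T$ let $s^{(T)}_1\ge s^{(T)}_2\ge\dots$ be the values $\|v_i-w_j\|$, $(i,j)\in T$, sorted non-increasingly, padded with zeros beyond $|T|$; $d_{k\text{ - }DTW}(\sigma,\tau)=\min_T\sum_{l=1}^k s^{(T)}_l$. Running time counts each vertex-to-vertex distance computation and each arithmetic operation as unit cost. -}

module Defs where

open import Algebra.Structures using (IsCommutativeRing)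
open import Algebra.Bundles using (CommutativeRing)
import Algebra.Definitions.RawMonoid as RawMonoidDefs
import Algebra.Construct.NaturalChoice.Max as NaturalMax
open import Data.Bool.Base using (Bool; if_then_else_)
open import Data.Fin.Base as Fin using (Fin; zero; suc; toℕ; fromℕ)
import Data.Fin.Properties as Fin
open import Data.List.Base as List using (List; []; _∷_; _++_; _∷ʳ_; allFin; cartesianProduct; deduplicate; length; map; replicate; take)
import Data.List.Properties as List
open import Data.List.Sort using (sort)
open import Data.Nat.Base as ℕ using (ℕ; zero; suc)
import Data.Nat.Properties as ℕ
open import Data.Product.Base using (∃; ∃₂; _×_; _,_; proj₁; proj₂)
open import Data.Sum.Base using (_⊎_; inj₁; inj₂)
open import Data.Vec.Base as Vec using (Vec; []; _∷_)
import Data.Vec.Properties as Vec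
open import Data.Vec.Functional using (Vector)
open import Level using (Level; _⊔_) renaming (suc to lsuc)
open import Relation.Binary.Bundles using (DecTotalOrder)
import Relation.Binary.Construct.Add.Supremum.NonStrict as AddSupremum
import Relation.Binary.Construct.Flip.EqAndOrd as Flip
open import Relation.Binary.Core using (Rel)
open import Relation.Binary.PropositionalEquality using (_≡_; refl; sym; trans; cong; subst)
open import Relation.Binary.Structures using (IsDecTotalOrder)
open import Relation.Nullary using (¬_)
open import Relation.Nullary.Decidable.Core using (does; yes; no)
open import Relation.Nullary.Construct.Add.Supremum using (_⁺; ⊤⁺; [_])
open import Relation.Unary using (Pred)

-- The reals, axiomatised as a Dedekind-complete ordered field. Decidability of
-- the order holds classically, and is the comparison primitive of the unit-cost
-- real-arithmetic machine. The operation √ is uniquely determined on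
-- non-negative elements, where it exists by completeness.
record CompleteOrderedField (c ℓ₁ ℓ₂ : Level) : Set (lsuc (c ⊔ ℓ₁ ⊔ ℓ₂)) where
  infix  8 -_
  infixl 7 _*_
  infixl 6 _+_ _-_
  infix  4 _≈_ _≤_
  field
    Carrier           : Set c
    _≈_               : Rel Carrier ℓ₁
    _≤_               : Rel Carrier ℓ₂
    _+_ _*_           : Carrier → Carrier → Carrier
    -_                : Carrier → Carrier
    0# 1#             : Carrier
    isCommutativeRing : IsCommutativeRing _≈_ _+_ _*_ -_ 0# 1#
    isDecTotalOrder   : IsDecTotalOrder _≈_ _≤_
    0≉1               : ¬ 0# ≈ 1#
    inverse           : ∀ x → ¬ x ≈ 0# → ∃ λ y → x * y ≈ 1#
    +-monoˡ-≤         : ∀ z {x y} → x ≤ y → x + z ≤ y + z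
    *-nonNeg          : ∀ {x y} → 0# ≤ x → 0# ≤ y → 0# ≤ x * y

  UpperBound : ∀ {p} → Pred Carrier p → Pred Carrier (c ⊔ ℓ₂ ⊔ p)
  UpperBound P u = ∀ x → P x → x ≤ u

  field
    supremum : (P : Pred Carrier (c ⊔ ℓ₁ ⊔ ℓ₂)) → ∃ P → ∃ (UpperBound P) →
               ∃ λ s → UpperBound P s × (∀ u → UpperBound P u → s ≤ u)
    √        : Carrier → Carrier
    √-nonNeg : ∀ {x} → 0# ≤ x → 0# ≤ √ x
    √-square : ∀ {x} → 0# ≤ x → √ x * √ x ≈ x

  commutativeRing : CommutativeRing c ℓ₁
  commutativeRing = record { isCommutativeRing = isCommutativeRing }

  decTotalOrder : DecTotalOrder c ℓ₁ ℓ₂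
  decTotalOrder = record { isDecTotalOrder = isDecTotalOrder }

  _-_ : Carrier → Carrier → Carrier
  x - y = x + (- y)

-- The index pairs of a matrix with suc p rows and suc q columns, counted from 0.
Index : ℕ → ℕ → Set
Index p q = Fin (suc p) × Fin (suc q)

data Step {p q} : Index p q → Index p q → Set where
  step-i  : ∀ {i i′ j}    → toℕ i′ ≡ suc (toℕ i) → Step (i , j) (i′ , j)
  step-j  : ∀ {i j j′}    → toℕ j′ ≡ suc (toℕ j) → Step (i , j) (i , j′)
  step-ij : ∀ {i i′ j j′} → toℕ i′ ≡ suc (toℕ i) → toℕ j′ ≡ suc (toℕ j) →
            Step (i , j) (i′ , j′)

infixl 5 _▸_

data TraversalTo {p q} : Index p q → Set where
  start : TraversalTo (zero , zero)
  _▸_   : ∀ {x y} → TraversalTo x → Step x y → TraversalTo y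

Traversal : ℕ → ℕ → Set
Traversal p q = TraversalTo {p} {q} (fromℕ p , fromℕ q)

indices : ∀ {p q} {x : Index p q} → TraversalTo x → List (Index p q)
indices start             = (zero , zero) ∷ []
indices (_▸_ {y = y} T _) = indices T ∷ʳ y

-- Computations together with the number of unit-cost operations performed.
record Timed {a} (A : Set a) : Set a where
  constructor _after_
  field
    value : A
    cost  : ℕ

open Timed public

infix 2 _after_
infixl 1 _>>=_

return : ∀ {a} {A : Set a} → A → Timed A
return x = x after 0

_>>=_ : ∀ {a b} {A : Set a} {B : Set b} → Timed A → (A → Timed B) → Timed B
(x after s) >>= f = value (f x) after s ℕ.+ cost (f x)

unitCost : ∀ {a} {A : Set a} → A → Timed A
unitCost x = x after 1

forEach : ∀ {a b} {A : Set a} {B : Set b} {n} → Vec A n → (A → Timed B) → Timed (Vec B n)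
forEach []       f = return []
forEach (x ∷ xs) f = do
  y  ← f x
  ys ← forEach xs f
  return (y ∷ ys)

module KDTW {c ℓ₁ ℓ₂} (R : CompleteOrderedField c ℓ₁ ℓ₂) where
  open CompleteOrderedField R renaming (Carrier to ℝ)
  open DecTotalOrder decTotalOrder using (_≟_; _≤?_; totalOrder)
  open NaturalMax totalOrder using () renaming (_⊔_ to max)
  open AddSupremum _≤_ using (_≤⁺_; _≤⊤⁺; [_]; ≤⁺-dec)
  open RawMonoidDefs (CommutativeRing.+-rawMonoid commutativeRing)
    using () renaming (sum to ∑; _×_ to _·_)

  ℝ^ : ℕ → Set c
  ℝ^ d = Vector ℝ d

  Curve : ℕ → ℕ → Set c
  Curve d m = Vector (ℝ^ d) m

  dist : ∀ {d} → ℝ^ d → ℝ^ d → ℝ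
  dist v w = √ (∑ λ i → (v i - w i) * (v i - w i))

  sum : List ℝ → ℝ
  sum = List.foldr _+_ 0#

  IsMinimum : ∀ {a} {A : Set a} → (A → ℝ) → ℝ → Set (a ⊔ ℓ₁ ⊔ ℓ₂)
  IsMinimum f r = (∃ λ x → f x ≈ r) × (∀ x → r ≤ f x)

  Matrix : ℕ → ℕ → Set c
  Matrix m n = Vec (Vec ℝ n) m

  _!_ : ∀ {p q} → Matrix (suc p) (suc q) → Index p q → ℝ
  D ! (i , j) = Vec.lookup (Vec.lookup D i) j

  traversalSum : ∀ {p q} → Matrix (suc p) (suc q) → {x : Index p q} → TraversalTo x → ℝ
  traversalSum D T = sum (map (D !_) (indices T))

  IsDTW : ∀ {p q} → Matrix (suc p) (suc q) → ℝ → Set (ℓ₁ ⊔ ℓ₂)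
  IsDTW {p} {q} D = IsMinimum {A = Traversal p q} (traversalSum D)

  distAt : ∀ {d p q} → Curve d (suc p) → Curve d (suc q) → Index p q → ℝ
  distAt σ τ (i , j) = dist (σ i) (τ j)

  sortDecreasing : List ℝ → List ℝ
  sortDecreasing = sort (Flip.decTotalOrder decTotalOrder)

  topSum : ℕ → List ℝ → ℝ
  topSum k xs = sum (take k (sortDecreasing xs ++ replicate k 0#))

  IsKDTW : ∀ {d p q} → ℕ → Curve d (suc p) → Curve d (suc q) → ℝ → Set (ℓ₁ ⊔ ℓ₂)
  IsKDTW {p = p} {q} k σ τ =
    IsMinimum {A = Traversal p q} λ T → topSum k (map (distAt σ τ) (indices T))

  numDistances : ∀ {d p q} → Curve d (suc p) → Curve d (suc q) → ℕ
  numDistances {p = p} {q} σ τ =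
    length (deduplicate _≟_
      (map (distAt σ τ) (cartesianProduct (allFin (suc p)) (allFin (suc q)))))

  -- The unit-cost primitives. The algorithm below handles reals only through
  -- these, comparisons being charged like arithmetic operations; an element of
  -- ℝ ⁺ is a real or ∞ = ⊤⁺.

  _+⁺_ : ℝ → ℝ ⁺ → ℝ ⁺
  x +⁺ ⊤⁺    = ⊤⁺
  x +⁺ [ y ] = [ x + y ]

  min⁺ : ℝ ⁺ → ℝ ⁺ → ℝ ⁺
  min⁺ x y = if does (≤⁺-dec _≤?_ x y) then x else y

  distᵗ : ∀ {d} → ℝ^ d → ℝ^ d → Timed ℝ
  distᵗ v w = unitCost (dist v w)

  _-ᵗ_ maxᵗ : ℝ → ℝ → Timed ℝ
  x -ᵗ y = unitCost (x - y)
  maxᵗ x y = unitCost (max x y)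

  _·ᵗ_ : ℕ → ℝ → Timed ℝ
  k ·ᵗ x = unitCost (k · x)

  _≤ᵗ_ : ℝ → ℝ → Timed Bool
  x ≤ᵗ y = unitCost (does (x ≤? y))

  _+ᵗ_ : ℝ → ℝ ⁺ → Timed (ℝ ⁺)
  x +ᵗ y = unitCost (x +⁺ y)

  minᵗ : ℝ ⁺ → ℝ ⁺ → Timed (ℝ ⁺)
  minᵗ x y = unitCost (min⁺ x y)

  -- Dynamic program for DTW: with i, j counted from 1 and the border values
  -- C[0,0] = 0 and C[i,0] = C[0,j] = ∞ otherwise,
  --   C[i,j] = D[i,j] + min {C[i-1,j-1], C[i,j-1], C[i-1,j]}.
  -- The arguments of dtwRow are C[i-1,j-1], C[i,j-1] and the remaining parts of
  -- row i-1 of C and of row i of D; those of dtwRows are C[i-1,0], row i-1 of C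
  -- and the remaining rows of D.

  dtwRow : ∀ {n} → ℝ ⁺ → ℝ ⁺ → Vec (ℝ ⁺) n → Vec ℝ n → Timed (Vec (ℝ ⁺) n)
  dtwRow diag left []         []       = return []
  dtwRow diag left (up ∷ ups) (x ∷ xs) = do
    a  ← minᵗ left up
    b  ← minᵗ diag a
    y  ← x +ᵗ b
    ys ← dtwRow up y ups xs
    return (y ∷ ys)

  dtwRows : ∀ {m n} → ℝ ⁺ → Vec (ℝ ⁺) n → Matrix m n → Timed (Vec (ℝ ⁺) n)
  dtwRows corner prev []       = return prev
  dtwRows corner prev (r ∷ rs) = do
    cur ← dtwRow corner ⊤⁺ prev r
    dtwRows ⊤⁺ cur rs

  dtw : ∀ {p q} → Matrix (suc p) (suc q) → Timed (ℝ ⁺)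
  dtw D = do
    row ← dtwRows [ 0# ] (Vec.replicate _ ⊤⁺) D
    return (Vec.last row)

  -- Insertion into a strictly decreasing list, dropping duplicates.
  insertDistinct : ℝ → List ℝ → Timed (List ℝ)
  insertDistinct x []       = return (x ∷ [])
  insertDistinct x (y ∷ ys) = do
    y≤x ← y ≤ᵗ x
    x≤y ← x ≤ᵗ y
    if y≤x then return (if x≤y then y ∷ ys else x ∷ y ∷ ys) else (do
      zs ← insertDistinct x ys
      return (y ∷ zs))

  insertAll : List ℝ → List ℝ → Timed (List ℝ)
  insertAll []       es = return es
  insertAll (x ∷ xs) es = do
    es′ ← insertDistinct x es
    insertAll xs es′

  entries : ∀ {m n} → Matrix m n → List ℝ
  entries D = Vec.toList (Vec.concat D)

  distinctDecreasing : ∀ {m n} → Matrix m n → Timed (List ℝ)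
  distinctDecreasing D = insertAll (entries D) []

  truncate : ∀ {m n} → ℝ → Matrix m n → Timed (Matrix m n)
  truncate e D = forEach D λ row → forEach row λ x → do
    y ← x -ᵗ e
    maxᵗ y 0#

  loop : ∀ {p q} → ℕ → Matrix (suc p) (suc q) → List ℝ → ℝ ⁺ → Timed (ℝ ⁺)
  loop k D []       mincost = return mincost
  loop k D (e ∷ es) mincost = do
    D′       ← truncate e D
    s        ← dtw D′
    ke       ← k ·ᵗ e
    t        ← ke +ᵗ s
    mincost′ ← minᵗ mincost t
    loop k D es mincost′

  -- E is E[1], …, E[z], E[z+1] = 0. If 0 is itself a distance then
  -- E[z] = E[z+1] = 0 and the last two rounds coincide.
  algorithm : ∀ {d p q} → Curve d (suc p) → Curve d (suc q) → ℕ → Timed (ℝ ⁺)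
  algorithm σ τ k = do
    D ← forEach (Vec.tabulate σ) λ v → forEach (Vec.tabulate τ) λ w → distᵗ v w
    E ← distinctDecreasing D
    loop k D (E ∷ʳ 0#) ⊤⁺

  open CommutativeRing commutativeRing
    using (+-congˡ; +-congʳ; +-comm; +-assoc)
    renaming (refl to ≈-refl; sym to ≈-sym; trans to ≈-trans)
  open DecTotalOrder decTotalOrder
    using (≤-respˡ-≈; ≤-respʳ-≈) renaming (trans to ≤-trans; refl to ≤-refl; total to ≤-total)
  open AddSupremum _≤_ using (≤⁺-trans; ≤⁺-total)

  +-monoʳ-≤ : ∀ z {x y} → x ≤ y → z + x ≤ z + y
  +-monoʳ-≤ z x≤y = ≤-respˡ-≈ (+-comm _ z) (≤-respʳ-≈ (+-comm _ z) (+-monoˡ-≤ z x≤y))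

  sum-∷ʳ : ∀ xs x → sum (xs ∷ʳ x) ≈ x + sum xs
  sum-∷ʳ []       x = ≈-refl
  sum-∷ʳ (y ∷ ys) x = ≈-trans (+-congˡ (sum-∷ʳ ys x))
    (≈-trans (≈-sym (+-assoc y x _)) (≈-trans (+-congʳ (+-comm y x)) (+-assoc x y _)))

  min⁺-sel : ∀ x y → min⁺ x y ≡ x ⊎ min⁺ x y ≡ y
  min⁺-sel x y with ≤⁺-dec _≤?_ x y
  ... | yes _ = inj₁ refl
  ... | no  _ = inj₂ refl

  ≤⁺-refl : ∀ x → x ≤⁺ x
  ≤⁺-refl ⊤⁺    = ⊤⁺ ≤⊤⁺
  ≤⁺-refl [ x ] = [ ≤-refl ]

  min⁺-≤ : ∀ x y → min⁺ x y ≤⁺ x × min⁺ x y ≤⁺ y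
  min⁺-≤ x y with ≤⁺-dec _≤?_ x y
  ... | yes x≤y = ≤⁺-refl x , x≤y
  ... | no  x≰y with ≤⁺-total ≤-total x y
  ...   | inj₁ x≤y with () ← x≰y x≤y
  ...   | inj₂ y≤x = y≤x , ≤⁺-refl y

  -- The dynamic program computes DTW as defined by minimising over traversals.
  module _ {p q} (D : Matrix (suc p) (suc q)) where
    private
      -- Sums of traversals to C[a,b], including the border of C.
      data Reaches : ℕ → ℕ → ℝ → Set c where
        origin : Reaches 0 0 0#
        inside : ∀ {a b i j} → toℕ i ≡ a → toℕ j ≡ b → (T : TraversalTo (i , j)) →
                 Reaches (suc a) (suc b) (traversalSum D T)

      record Cell (a b : ℕ) (v : ℝ ⁺) : Set (c ⊔ ℓ₁ ⊔ ℓ₂) where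
        constructor _,_
        field
          lower    : ∀ {s} → Reaches a b s → v ≤⁺ [ s ]
          attained : ∀ {r} → v ≡ [ r ] → ∃ λ s → Reaches a b s × s ≈ r

      castCell : ∀ {a a′ b b′ v} → a ≡ a′ → b ≡ b′ → Cell a b v → Cell a′ b′ v
      castCell refl refl x = x

      Entry : ℕ → ℕ → ℝ → Set c
      Entry a b x = ∃₂ λ i j → toℕ i ≡ a × toℕ j ≡ b × x ≡ D ! (i , j)

      castEntry : ∀ {a a′ b b′ x} → a ≡ a′ → b ≡ b′ → Entry a b x → Entry a′ b′ x
      castEntry refl refl x = x

      Before : ℕ → ℕ → ℝ → Set c
      Before a b s = Reaches a b s ⊎ Reaches (suc a) b s ⊎ Reaches a (suc b) s

      traversalSum-▸ : ∀ {x y} (T : TraversalTo x) (s : Step x y) →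
                       traversalSum D (T ▸ s) ≈ D ! y + traversalSum D T
      traversalSum-▸ {y = y} T s rewrite List.map-++ (D !_) (indices T) (y ∷ []) =
        sum-∷ʳ (map (D !_) (indices T)) _

      unextend : ∀ {a b x s} → Entry a b x → Reaches (suc a) (suc b) s →
                 ∃ λ t → Before a b t × s ≈ x + t
      unextend (i , j , refl , refl , refl) (inside {i = i′} {j′} i≡ j≡ T)
        with refl ← Fin.toℕ-injective i≡ | refl ← Fin.toℕ-injective j≡ = last T
        where
        last : (T : TraversalTo (i , j)) →
               ∃ λ t → Before (toℕ i) (toℕ j) t × traversalSum D T ≈ D ! (i , j) + t
        last start = 0# , inj₁ origin , ≈-refl
        last (T ▸ s@(step-i i≡)) rewrite i≡ =
          _ , inj₂ (inj₂ (inside refl refl T)) , traversalSum-▸ T s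
        last (T ▸ s@(step-j j≡)) rewrite j≡ =
          _ , inj₂ (inj₁ (inside refl refl T)) , traversalSum-▸ T s
        last (T ▸ s@(step-ij i≡ j≡)) rewrite i≡ | j≡ =
          _ , inj₁ (inside refl refl T) , traversalSum-▸ T s

      extend : ∀ {a b x t} → Entry a b x → Before a b t →
               ∃ λ s → Reaches (suc a) (suc b) s × s ≈ x + t
      extend (i , j , i≡ , j≡ , refl) (inj₁ origin)
        with refl ← Fin.toℕ-injective {i = i} {zero} i≡
           | refl ← Fin.toℕ-injective {i = j} {zero} j≡ =
        _ , inside refl refl start , ≈-refl
      extend (i , j , i≡ , j≡ , refl) (inj₁ (inside refl refl T)) =
        _ , inside i≡ j≡ (T ▸ step-ij i≡ j≡) , traversalSum-▸ T (step-ij i≡ j≡)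
      extend (i , j , i≡ , j≡ , refl) (inj₂ (inj₁ (inside {i = i′} i′≡ refl T)))
        with refl ← Fin.toℕ-injective {i = i} {i′} (trans i≡ (sym i′≡)) =
        _ , inside i≡ j≡ (T ▸ step-j j≡) , traversalSum-▸ T (step-j j≡)
      extend (i , j , i≡ , j≡ , refl) (inj₂ (inj₂ (inside {j = j′} refl j′≡ T)))
        with refl ← Fin.toℕ-injective {i = j} {j′} (trans j≡ (sym j′≡)) =
        _ , inside i≡ j≡ (T ▸ step-i i≡) , traversalSum-▸ T (step-i i≡)

      cell : ∀ {a b x diag left up} → Entry a b x →
             Cell a b diag → Cell (suc a) b left → Cell a (suc b) up →
             Cell (suc a) (suc b) (x +⁺ min⁺ diag (min⁺ left up))
      cell {a} {b} {x} {diag} {left} {up} e (d≤ , d∈) (l≤ , l∈) (u≤ , u∈) = lower , attained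
        where
        v : ℝ ⁺
        v = min⁺ diag (min⁺ left up)
        infixr 5 _⟫_
        _⟫_ : ∀ {x y z} → x ≤⁺ y → y ≤⁺ z → x ≤⁺ z
        _⟫_ = ≤⁺-trans ≤-trans
        before : ∀ {t} → Before a b t → v ≤⁺ [ t ]
        before (inj₁ r)        = proj₁ (min⁺-≤ diag (min⁺ left up)) ⟫ d≤ r
        before (inj₂ (inj₁ r)) = proj₂ (min⁺-≤ diag (min⁺ left up)) ⟫ proj₁ (min⁺-≤ left up) ⟫ l≤ r
        before (inj₂ (inj₂ r)) = proj₂ (min⁺-≤ diag (min⁺ left up)) ⟫ proj₂ (min⁺-≤ left up) ⟫ u≤ r
        add : ∀ {w t s} → s ≈ x + t → w ≤⁺ [ t ] → (x +⁺ w) ≤⁺ [ s ]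
        add eq [ w≤t ] = [ ≤-respʳ-≈ (≈-sym eq) (+-monoʳ-≤ x w≤t) ]
        lower : ∀ {s} → Reaches (suc a) (suc b) s → (x +⁺ v) ≤⁺ [ s ]
        lower r with t , pre , eq ← unextend e r = add eq (before pre)
        choose : ∀ {r} → v ≡ [ r ] → ∃ λ t → Before a b t × t ≈ r
        choose v≡ with min⁺-sel diag (min⁺ left up)
        ... | inj₁ eq with t , pre , t≈ ← d∈ (trans (sym eq) v≡) = t , inj₁ pre , t≈
        ... | inj₂ eq with min⁺-sel left up
        ...   | inj₁ eq′ with t , pre , t≈ ← l∈ (trans (sym (trans eq eq′)) v≡) =
                  t , inj₂ (inj₁ pre) , t≈
        ...   | inj₂ eq′ with t , pre , t≈ ← u∈ (trans (sym (trans eq eq′)) v≡) =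
                  t , inj₂ (inj₂ pre) , t≈
        finish : ∀ w → v ≡ w → ∀ {r} → (x +⁺ w) ≡ [ r ] →
                 ∃ λ s → Reaches (suc a) (suc b) s × s ≈ r
        finish [ w ] v≡ refl with t , pre , t≈ ← choose v≡
                             with s , r , s≈ ← extend e pre =
          s , r , ≈-trans s≈ (+-congˡ t≈)
        attained : ∀ {r} → (x +⁺ v) ≡ [ r ] → ∃ λ s → Reaches (suc a) (suc b) s × s ≈ r
        attained = finish v refl

      -- No traversal reaches the border outside C[0,0].
      border-i : ∀ {a} → Cell (suc a) 0 ⊤⁺
      border-i = (λ ()) , λ ()

      border-j : ∀ {b} → Cell 0 (suc b) ⊤⁺
      border-j = (λ ()) , λ ()

      corner₀ : Cell 0 0 [ 0# ]
      corner₀ = (λ { origin → [ ≤-refl ] }) , λ { refl → 0# , origin , ≈-refl }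

      row-cells : ∀ {n} a o diag left (us : Vec (ℝ ⁺) n) (xs : Vec ℝ n) →
        Cell a o diag → Cell (suc a) o left →
        (∀ j → Cell a (suc (o ℕ.+ toℕ j)) (Vec.lookup us j)) →
        (∀ j → Entry a (o ℕ.+ toℕ j) (Vec.lookup xs j)) →
        ∀ j → Cell (suc a) (suc (o ℕ.+ toℕ j)) (Vec.lookup (value (dtwRow diag left us xs)) j)
      row-cells a o diag left (u ∷ us) (x ∷ xs) d l up en = λ where
          zero    → castCell refl (cong suc (sym (ℕ.+-identityʳ o))) first
          (suc j) → castCell refl (cong suc (sym (ℕ.+-suc o (toℕ j))))
            (row-cells a (suc o) u _ us xs u₀ first
              (λ j → castCell refl (cong suc (ℕ.+-suc o (toℕ j))) (up (suc j)))
              (λ j → castEntry refl (ℕ.+-suc o (toℕ j)) (en (suc j))) j)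
        where
        u₀ : Cell a (suc o) u
        u₀ = castCell refl (cong suc (ℕ.+-identityʳ o)) (up zero)
        first : Cell (suc a) (suc o) (x +⁺ min⁺ diag (min⁺ left u))
        first = cell (castEntry refl (ℕ.+-identityʳ o) (en zero)) d l u₀

      rows-cells : ∀ {m} a corner (us : Vec (ℝ ⁺) (suc q)) (rs : Matrix m (suc q)) →
        Cell a 0 corner →
        (∀ j → Cell a (suc (toℕ j)) (Vec.lookup us j)) →
        (∀ i j → Entry (a ℕ.+ toℕ i) (toℕ j) (Vec.lookup (Vec.lookup rs i) j)) →
        ∀ j → Cell (a ℕ.+ m) (suc (toℕ j)) (Vec.lookup (value (dtwRows corner us rs)) j)
      rows-cells a corner us [] co up en j =
        castCell (sym (ℕ.+-identityʳ a)) refl (up j)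
      rows-cells {suc m} a corner us (r ∷ rs) co up en j =
        castCell (sym (ℕ.+-suc a m)) refl
          (rows-cells (suc a) ⊤⁺ _ rs border-i
            (row-cells a 0 corner ⊤⁺ us r co border-i up
              (λ j → castEntry (ℕ.+-identityʳ a) refl (en zero j)))
            (λ i j → castEntry (ℕ.+-suc a (toℕ i)) refl (en (suc i) j)) j)

      lookup-last : ∀ {n} (xs : Vec (ℝ ⁺) (suc n)) → Vec.lookup xs (fromℕ n) ≡ Vec.last xs
      lookup-last (x ∷ [])     = refl
      lookup-last (x ∷ y ∷ ys) = lookup-last (y ∷ ys)

      reach : ∀ a b i j → toℕ i ≡ a → toℕ j ≡ b → TraversalTo {p} {q} (i , j)
      reach zero    zero    zero    zero    _    _    = start
      reach zero    (suc b) zero    (suc j) _    refl =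
        reach zero b zero (Fin.inject₁ j) refl (Fin.toℕ-inject₁ j)
          ▸ step-j (cong suc (sym (Fin.toℕ-inject₁ j)))
      reach (suc a) b       (suc i) j       refl eq   =
        reach a b (Fin.inject₁ i) j (Fin.toℕ-inject₁ i) eq
          ▸ step-i (cong suc (sym (Fin.toℕ-inject₁ i)))

      corner-cell : Cell (suc p) (suc q) (value (dtw D))
      corner-cell = subst (Cell (suc p) (suc q)) (lookup-last row)
        (castCell refl (cong suc (Fin.toℕ-fromℕ q))
          (rows-cells 0 [ 0# ] ∞s D corner₀
            (λ j → subst (Cell 0 _) (sym (Vec.lookup-replicate j ⊤⁺)) border-j)
            (λ i j → i , j , refl , refl , refl) (fromℕ q)))
        where
        ∞s row : Vec (ℝ ⁺) (suc q)
        ∞s = Vec.replicate _ ⊤⁺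
        row = value (dtwRows [ 0# ] ∞s D)

    dtw-isDTW : ∃ λ r → value (dtw D) ≡ [ r ] × IsDTW D r
    dtw-isDTW = finish _ refl corner-cell
      where
      at-end : ∀ {T} → Reaches (suc p) (suc q) T → ∃ λ (S : Traversal p q) → traversalSum D S ≡ T
      at-end (inside i≡ j≡ T)
        with refl ← Fin.toℕ-injective (trans i≡ (sym (Fin.toℕ-fromℕ p)))
           | refl ← Fin.toℕ-injective (trans j≡ (sym (Fin.toℕ-fromℕ q))) = T , refl
      here : (T : Traversal p q) → Reaches (suc p) (suc q) (traversalSum D T)
      here = inside (Fin.toℕ-fromℕ p) (Fin.toℕ-fromℕ q)
      finish : ∀ v → value (dtw D) ≡ v → Cell (suc p) (suc q) v →
               ∃ λ r → value (dtw D) ≡ [ r ] × IsDTW D r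
      finish ⊤⁺ eq (lo , _) with () ← lo (here (reach _ _ _ _ refl refl))
      finish [ r ] eq (lo , at) with s , reaches , s≈ ← at refl
                                with T , refl ← at-end reaches =
        r , eq , (T , s≈) , λ S → AddSupremum.[≤]-injective _≤_ (lo (here S))

{-# OPTIONS --safe #-}
module Submission where

-- For a threshold e ≥ 0 and a traversal T, the k largest distances on T sum to
-- at most k e + Σ max(x - e, 0), with equality when e is the k-th largest one
-- (0 if T has fewer than k pairs, E[1] if k = 0). All these
-- thresholds occur among the E[l], so minimising over e and T in either order
-- gives the same value. For the running time, every intermediate list of
-- distinct distances has at most z entries, and the z + 1 ≤ 2z rounds take
-- 5m′m″ + 3 ≤ 8m′m″ operations each, whence the constant 1 + 2 + 16 = 19.

open import Defs
open import Algebra.Bundles using (CommutativeRing)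
import Algebra.Construct.NaturalChoice.Max as NaturalMax
import Algebra.Definitions.RawMonoid as RawMonoidDefs
import Algebra.Properties.CommutativeSemigroup as CommutativeSemigroupProperties
import Algebra.Properties.Group as GroupProperties
import Algebra.Properties.Ring as RingProperties
open import Data.Fin.Base using (Fin; zero; suc)
import Data.Fin.Properties as Fin
open import Data.List.Base as List using (List; []; _∷_; _++_; _∷ʳ_; allFin; cartesianProduct; deduplicate; length; map; replicate; take)
import Data.List.Properties as List
open import Data.List.Membership.Propositional using (_∈_; find)
open import Data.List.Membership.Propositional.Properties using (∈-++⁺ˡ; ∈-++⁺ʳ; ∈-allFin; ∈-cartesianProduct⁺; ∈-map⁺; ∈-lookup)
import Data.List.Membership.Setoid as SetoidMembership
import Data.List.Membership.Setoid.Properties as SetoidMembershipProperties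
open import Data.List.Relation.Binary.Permutation.Propositional using (_↭_; ↭-sym; ↭⇒↭ₛ′)
import Data.List.Relation.Binary.Permutation.Propositional.Properties as Perm
import Data.List.Relation.Binary.Permutation.Setoid.Properties as SetoidPerm
open import Data.List.Relation.Unary.All as All using (All; []; _∷_)
import Data.List.Relation.Unary.All.Properties as All
open import Data.List.Relation.Unary.AllPairs using (AllPairs; []; _∷_)
open import Data.List.Relation.Unary.Any as Any using (here; there)
import Data.List.Relation.Unary.Sorted.TotalOrder.Properties as Sorted
open import Data.List.Sort using (sort-↭; sort-↗)
open import Data.Nat.Base as ℕ using (ℕ; zero; suc; z≤n; s≤s)
import Data.Nat.Properties as ℕ
open import Data.Nat.Solver using (module +-*-Solver)
open import Data.Product.Base using (∃; _×_; _,_; proj₁; proj₂)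
open import Data.Sum.Base using (_⊎_; inj₁; inj₂)
open import Data.Vec.Base as Vec using (Vec; []; _∷_)
import Data.Vec.Properties as Vec
import Data.Vec.Relation.Unary.All.Properties as VecAll
import Data.Vec.Relation.Unary.Any as VecAny
import Data.Vec.Relation.Unary.Any.Properties as VecAny
import Data.Vec.Membership.Propositional.Properties as VecMembership
open import Function.Base using (flip; _∘_)
open import Relation.Binary.Bundles using (DecTotalOrder)
import Relation.Binary.Construct.Add.Supremum.NonStrict as AddSupremum
import Relation.Binary.Construct.Flip.EqAndOrd as Flip
open import Relation.Binary.PropositionalEquality using (_≡_; refl; sym; trans; cong; cong₂; subst)
import Relation.Binary.Reasoning.PartialOrder as PosetReasoning
open import Relation.Nullary using (¬_; yes; no; contradiction)
open import Relation.Nullary.Construct.Add.Supremum using (_⁺; ⊤⁺; [_])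
open import Relation.Unary using (Pred)

-- Values and costs of `forEach`

forEach-lookup : ∀ {a b} {A : Set a} {B : Set b} {n} (xs : Vec A n) (f : A → Timed B) i →
                 Vec.lookup (value (forEach xs f)) i ≡ value (f (Vec.lookup xs i))
forEach-lookup (x ∷ xs) f zero    = refl
forEach-lookup (x ∷ xs) f (suc i) = forEach-lookup xs f i

forEach-cost : ∀ {a b} {A : Set a} {B : Set b} {n k} (xs : Vec A n) (f : A → Timed B) →
               (∀ x → cost (f x) ≡ k) → cost (forEach xs f) ≡ n ℕ.* k
forEach-cost []       f f≡ = refl
forEach-cost (x ∷ xs) f f≡ =
  cong₂ ℕ._+_ (f≡ x) (trans (ℕ.+-identityʳ _) (forEach-cost xs f f≡))

module Analysis {c ℓ₁ ℓ₂} (R : CompleteOrderedField c ℓ₁ ℓ₂) where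
  open KDTW R
  open CompleteOrderedField R renaming (Carrier to ℝ)
  open DecTotalOrder decTotalOrder
    using (_≟_; _≤?_; totalOrder; poset; antisym; ≤-respˡ-≈; ≤-respʳ-≈; module Eq)
    renaming (refl to ≤-refl; trans to ≤-trans; total to ≤-total; reflexive to ≤-reflexive)
  open CommutativeRing commutativeRing
    using (ring; +-isCommutativeMonoid; +-commutativeSemigroup; +-group; +-rawMonoid;
           +-congˡ; +-comm; +-assoc; -‿cong; +-identityˡ; +-identityʳ; -‿inverseˡ; -‿inverseʳ; isEquivalence; setoid)
    renaming (refl to ≈-refl; sym to ≈-sym; trans to ≈-trans)
  open NaturalMax totalOrder using (x≤x⊔y; x≤y⊔x; ⊔-lub) renaming (_⊔_ to max)
  open AddSupremum _≤_ using (_≤⁺_; [_]; ≤⁺-trans)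
  open RawMonoidDefs +-rawMonoid using () renaming (sum to ∑; _×_ to _·_)
  open SetoidMembership setoid using () renaming (_∈_ to _∈ₛ_)
  open CommutativeSemigroupProperties +-commutativeSemigroup using (interchange)

  -- Order arithmetic and non-negativity of distances

  +-mono-≤ : ∀ {x y u v} → x ≤ y → u ≤ v → x + u ≤ y + v
  +-mono-≤ x≤y u≤v = ≤-trans (+-monoˡ-≤ _ x≤y) (+-monoʳ-≤ _ u≤v)

  +-nonNeg : ∀ {x y} → 0# ≤ x → 0# ≤ y → 0# ≤ x + y
  +-nonNeg 0≤x 0≤y = ≤-respˡ-≈ (+-identityˡ 0#) (+-mono-≤ 0≤x 0≤y)

  x-y+y≈x : ∀ x y → (x - y) + y ≈ x
  x-y+y≈x x y = ≈-trans (+-assoc x (- y) y) (≈-trans (+-congˡ (-‿inverseˡ y)) (+-identityʳ x))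

  x≤y⇒x-y≤0 : ∀ {x y} → x ≤ y → x - y ≤ 0#
  x≤y⇒x-y≤0 {y = y} x≤y = ≤-respʳ-≈ (-‿inverseʳ y) (+-monoˡ-≤ (- y) x≤y)

  y≤x⇒0≤x-y : ∀ {x y} → y ≤ x → 0# ≤ x - y
  y≤x⇒0≤x-y {y = y} y≤x = ≤-respˡ-≈ (-‿inverseʳ y) (+-monoˡ-≤ (- y) y≤x)

  -- The order axioms cover only products of non-negative elements, so a negative `x` is replaced by
  -- `- x`, which has the same square.
  square-nonNeg : ∀ x → 0# ≤ x * x
  square-nonNeg x with ≤-total 0# x
  ... | inj₁ 0≤x = *-nonNeg 0≤x 0≤x
  ... | inj₂ x≤0 = ≤-respʳ-≈ -x*-x≈x*x (*-nonNeg 0≤-x 0≤-x)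
    where
    open RingProperties ring using (-‿distribˡ-*; -‿distribʳ-*)
    open GroupProperties +-group using (⁻¹-involutive)
    0≤-x : 0# ≤ - x
    0≤-x = ≤-respʳ-≈ (+-identityˡ (- x)) (y≤x⇒0≤x-y x≤0)
    -x*-x≈x*x : - x * - x ≈ x * x
    -x*-x≈x*x = ≈-trans (≈-sym (-‿distribˡ-* x (- x)))
      (≈-trans (-‿cong (≈-sym (-‿distribʳ-* x x))) (⁻¹-involutive (x * x)))

  ∑-nonNeg : ∀ {n} (f : Fin n → ℝ) → (∀ i → 0# ≤ f i) → 0# ≤ ∑ f
  ∑-nonNeg {zero}  f 0≤f = ≤-refl
  ∑-nonNeg {suc n} f 0≤f = +-nonNeg (0≤f zero) (∑-nonNeg (f ∘ suc) (0≤f ∘ suc))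

  dist-nonNeg : ∀ {d} (v w : ℝ^ d) → 0# ≤ dist v w
  dist-nonNeg v w = √-nonNeg (∑-nonNeg _ λ i → square-nonNeg (v i - w i))

  ·-nonNeg : ∀ k {x} → 0# ≤ x → 0# ≤ k · x
  ·-nonNeg zero    0≤x = ≤-refl
  ·-nonNeg (suc k) 0≤x = +-nonNeg 0≤x (·-nonNeg k 0≤x)

  ·-zeroʳ : ∀ k → k · 0# ≈ 0#
  ·-zeroʳ zero    = ≈-refl
  ·-zeroʳ (suc k) = ≈-trans (+-identityˡ _) (·-zeroʳ k)

  -- Sums over lists and zero padding

  sum-↭ : ∀ {xs ys} → xs ↭ ys → sum xs ≈ sum ys
  sum-↭ xs↭ys = SetoidPerm.foldr-commMonoid setoid
    (+-isCommutativeMonoid) (↭⇒↭ₛ′ isEquivalence xs↭ys)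

  sum-replicate-0 : ∀ k n → sum (take k (replicate n 0#)) ≈ 0#
  sum-replicate-0 zero    n       = ≈-refl
  sum-replicate-0 (suc k) zero    = ≈-refl
  sum-replicate-0 (suc k) (suc n) = ≈-trans (+-identityˡ _) (sum-replicate-0 k n)

  -- The padding length `n` is kept apart from `k` because only `k` decreases in the induction;
  -- `topSum` is the case where both agree.
  sum-take-padded : ∀ k n xs → sum (take k (xs ++ replicate n 0#)) ≈ sum (take k xs)
  sum-take-padded zero    n xs       = ≈-refl
  sum-take-padded (suc k) n []       = sum-replicate-0 (suc k) n
  sum-take-padded (suc k) n (x ∷ xs) = +-congˡ (sum-take-padded k n xs)

  -- Thresholds and the sum of the k largest elements

  excess : ℝ → ℝ → ℝ
  excess e x = max (x - e) 0#

  sum-excess-nonNeg : ∀ e xs → 0# ≤ sum (map (excess e) xs)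
  sum-excess-nonNeg e []       = ≤-refl
  sum-excess-nonNeg e (x ∷ xs) = +-nonNeg (x≤y⊔x _ _) (sum-excess-nonNeg e xs)

  sum-excess-≤0 : ∀ {e xs} → All (_≤ e) xs → sum (map (excess e) xs) ≤ 0#
  sum-excess-≤0 []          = ≤-refl
  sum-excess-≤0 (x≤e ∷ xs≤e) = ≤-respʳ-≈ (+-identityˡ 0#)
    (+-mono-≤ (⊔-lub (x≤y⇒x-y≤0 x≤e) ≤-refl) (sum-excess-≤0 xs≤e))

  -- Every `x` taken satisfies `x ≤ e + excess e x`. Elements not taken have non-negative excess,
  -- and `0# ≤ e` covers the places left empty when `xs` has fewer than `k` elements.
  sum-take-≤ : ∀ {e} → 0# ≤ e → ∀ k xs → sum (take k xs) ≤ k · e + sum (map (excess e) xs)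
  sum-take-≤ {e} 0≤e zero    xs       = ≤-respʳ-≈ (≈-sym (+-identityˡ _)) (sum-excess-nonNeg e xs)
  sum-take-≤     0≤e (suc k) []       = +-nonNeg (·-nonNeg (suc k) 0≤e) ≤-refl
  sum-take-≤ {e} 0≤e (suc k) (x ∷ xs) = begin
    x + sum (take k xs)                           ≤⟨ +-mono-≤ x≤ (sum-take-≤ 0≤e k xs) ⟩
    (e + excess e x) + (k · e + sum (map (excess e) xs)) ≈⟨ interchange _ _ _ _ ⟩
    (e + k · e) + (excess e x + sum (map (excess e) xs)) ∎
    where
    open PosetReasoning poset
    x≤ : x ≤ e + excess e x
    x≤ = ≤-respˡ-≈ (≈-trans (+-comm _ _) (x-y+y≈x x e))
           (+-monoʳ-≤ e (x≤x⊔y (x - e) 0#))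

  -- The threshold e is the k-th largest element, or 0 when there are fewer than
  -- k elements, or the given bound M when k = 0. Members of P represent the
  -- elements of xs only up to ≈.
  sum-take-≥ : ∀ {p} {P : Pred ℝ p} → P 0# → (∀ {e} → P e → 0# ≤ e) →
    ∀ k xs {M} → P M → All (_≤ M) xs → AllPairs (flip _≤_) xs →
    All (λ x → ∃ λ e → P e × e ≈ x) xs →
    ∃ λ e → P e × e ≤ M × k · e + sum (map (excess e) xs) ≤ sum (take k xs)
  sum-take-≥ P0 0≤P zero xs {M} PM xs≤M dec ∃P =
    M , PM , ≤-refl , ≤-respˡ-≈ (≈-sym (+-identityˡ _)) (sum-excess-≤0 xs≤M)
  sum-take-≥ P0 0≤P (suc k) [] PM xs≤M dec ∃P =
    0# , P0 , 0≤P PM , ≤-reflexive (≈-trans (+-identityʳ _) (·-zeroʳ (suc k)))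
  sum-take-≥ P0 0≤P (suc k) (x ∷ xs) PM (x≤M ∷ _) (xs≤x ∷ dec) ((y , Py , y≈x) ∷ ∃P)
    -- The representative `y` of the head becomes the bound for the tail. The threshold found there
    -- therefore satisfies `e ≤ x`, which is what gives `e + excess e x ≤ x`.
    with e , Pe , e≤y , ih ← sum-take-≥ P0 0≤P k xs Py
           (All.map (≤-respʳ-≈ (≈-sym y≈x)) xs≤x) dec ∃P =
    e , Pe , ≤-trans e≤x x≤M , (begin
      (e + k · e) + (excess e x + sum (map (excess e) xs)) ≈⟨ interchange _ _ _ _ ⟩
      (e + excess e x) + (k · e + sum (map (excess e) xs)) ≤⟨ +-mono-≤ ≤x ih ⟩
      x + sum (take k xs)                                  ∎)
    where
    open PosetReasoning poset
    e≤x : e ≤ x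
    e≤x = ≤-respʳ-≈ y≈x e≤y
    ≤x : e + excess e x ≤ x
    ≤x = ≤-respʳ-≈ (≈-trans (+-comm _ _) (x-y+y≈x x e))
           (+-monoʳ-≤ e (⊔-lub ≤-refl (y≤x⇒0≤x-y e≤x)))

  private
    ≥-decTotalOrder : DecTotalOrder c ℓ₁ ℓ₂
    ≥-decTotalOrder = Flip.decTotalOrder decTotalOrder

  sum-excess-sort : ∀ e xs →
    sum (map (excess e) (sortDecreasing xs)) ≈ sum (map (excess e) xs)
  sum-excess-sort e xs = sum-↭ (Perm.map⁺ (excess e) (sort-↭ ≥-decTotalOrder xs))

  -- Used to show that the value of a round is at least the cost of the traversal that is optimal in
  -- that round.
  topSum-≤ : ∀ {e} → 0# ≤ e → ∀ k xs → topSum k xs ≤ k · e + sum (map (excess e) xs)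
  topSum-≤ {e} 0≤e k xs = begin
    topSum k xs                                       ≈⟨ sum-take-padded k k _ ⟩
    sum (take k (sortDecreasing xs))                  ≤⟨ sum-take-≤ 0≤e k _ ⟩
    k · e + sum (map (excess e) (sortDecreasing xs))  ≈⟨ +-congˡ (sum-excess-sort e xs) ⟩
    k · e + sum (map (excess e) xs)                   ∎
    where open PosetReasoning poset

  -- Used to find, for each traversal, a tried threshold whose round costs no more than that
  -- traversal.
  topSum-≥ : ∀ {p} {P : Pred ℝ p} → P 0# → (∀ {e} → P e → 0# ≤ e) →
    ∀ k xs {M} → P M → All (_≤ M) xs → All (λ x → ∃ λ e → P e × e ≈ x) xs →
    ∃ λ e → P e × k · e + sum (map (excess e) xs) ≤ topSum k xs
  topSum-≥ P0 0≤P k xs PM xs≤M ∃P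
    with e , Pe , _ , e≤ ← sum-take-≥ P0 0≤P k (sortDecreasing xs) PM
           (Perm.All-resp-↭ (↭-sym (sort-↭ ≥-decTotalOrder xs)) xs≤M)
           (Sorted.Sorted⇒AllPairs (DecTotalOrder.totalOrder ≥-decTotalOrder) (sort-↗ ≥-decTotalOrder xs))
           (Perm.All-resp-↭ (↭-sym (sort-↭ ≥-decTotalOrder xs)) ∃P) =
    e , Pe , (begin
      k · e + sum (map (excess e) xs)                  ≈⟨ +-congˡ (sum-excess-sort e xs) ⟨
      k · e + sum (map (excess e) (sortDecreasing xs)) ≤⟨ e≤ ⟩
      sum (take k (sortDecreasing xs))                 ≈⟨ sum-take-padded k k _ ⟨
      topSum k xs                                      ∎)
    where open PosetReasoning poset

  -- Strictly decreasing lists and insertion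

  infix 4 _≻_

  -- In a total order this is the strict order, in the form in which a failed comparison of
  -- `insertDistinct` delivers it.
  _≻_ : ℝ → ℝ → Set ℓ₂
  x ≻ y = ¬ x ≤ y

  ≻-trans : ∀ {x y z} → x ≻ y → y ≻ z → x ≻ z
  ≻-trans {y = y} {z} x≻y y≻z x≤z with ≤-total y z
  ... | inj₁ y≤z = y≻z y≤z
  ... | inj₂ z≤y = x≻y (≤-trans x≤z z≤y)

  ≻⇒≥ : ∀ {x y} → x ≻ y → y ≤ x
  ≻⇒≥ {x} {y} x≻y with ≤-total x y
  ... | inj₁ x≤y = contradiction x≤y x≻y
  ... | inj₂ y≤x = y≤x

  Decreasing : List ℝ → Set _
  Decreasing = AllPairs _≻_

  -- The predicate is arbitrary because it takes three roles: `y ≻_` for the ordering, `0# ≤_` for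
  -- the sign and `_∈ₛ zs` for the counting.
  insertDistinct-All : ∀ {p} {P : Pred ℝ p} {x} → P x → ∀ {es} → All P es →
                       All P (value (insertDistinct x es))
  insertDistinct-All px [] = px ∷ []
  insertDistinct-All {x = x} px {y ∷ ys} (py ∷ pys) with y ≤? x | x ≤? y
  ... | yes _ | yes _ = py ∷ pys
  ... | yes _ | no  _ = px ∷ py ∷ pys
  ... | no  _ | yes _ = py ∷ insertDistinct-All px pys
  ... | no  _ | no  _ = py ∷ insertDistinct-All px pys

  insertDistinct-Decreasing : ∀ x {es} → Decreasing es →
                              Decreasing (value (insertDistinct x es))
  insertDistinct-Decreasing x [] = [] ∷ []
  insertDistinct-Decreasing x {y ∷ ys} (y≻ ∷ dec) with y ≤? x | x ≤? y
  ... | yes _   | yes _   = y≻ ∷ dec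
  ... | yes _   | no  x≰y = (x≰y ∷ All.map (≻-trans x≰y) y≻) ∷ y≻ ∷ dec
  ... | no  y≰x | yes _   = insertDistinct-All y≰x y≻ ∷ insertDistinct-Decreasing x dec
  ... | no  y≰x | no  _   = insertDistinct-All y≰x y≻ ∷ insertDistinct-Decreasing x dec

  -- Membership is only up to `≈`: if an equal `y` is already present, `x` itself is dropped.
  insertDistinct-∈ₛ-new : ∀ x es → x ∈ₛ value (insertDistinct x es)
  insertDistinct-∈ₛ-new x [] = here ≈-refl
  insertDistinct-∈ₛ-new x (y ∷ ys) with y ≤? x | x ≤? y
  ... | yes y≤x | yes x≤y = here (antisym x≤y y≤x)
  ... | yes _   | no  _   = here ≈-refl
  ... | no  _   | yes _   = there (insertDistinct-∈ₛ-new x ys)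
  ... | no  _   | no  _   = there (insertDistinct-∈ₛ-new x ys)

  insertDistinct-∈ₛ-old : ∀ x {es z} → z ∈ₛ es → z ∈ₛ value (insertDistinct x es)
  insertDistinct-∈ₛ-old x {y ∷ ys} z∈ with y ≤? x | x ≤? y
  ... | yes _ | yes _ = z∈
  ... | yes _ | no  _ = there z∈
  insertDistinct-∈ₛ-old x {y ∷ ys} (here z≈y) | no _ | yes _ = here z≈y
  insertDistinct-∈ₛ-old x {y ∷ ys} (there z∈) | no _ | yes _ = there (insertDistinct-∈ₛ-old x z∈)
  insertDistinct-∈ₛ-old x {y ∷ ys} (here z≈y) | no _ | no  _ = here z≈y
  insertDistinct-∈ₛ-old x {y ∷ ys} (there z∈) | no _ | no  _ = there (insertDistinct-∈ₛ-old x z∈)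

  -- Two comparisons for each element visited, and each element is visited at most once.
  insertDistinct-cost : ∀ x es → cost (insertDistinct x es) ℕ.≤ length es ℕ.* 2
  insertDistinct-cost x [] = z≤n
  insertDistinct-cost x (y ∷ ys) with y ≤? x | x ≤? y
  ... | yes _ | yes _ = s≤s (s≤s z≤n)
  ... | yes _ | no  _ = s≤s (s≤s z≤n)
  ... | no  _ | yes _ = s≤s (s≤s (subst (ℕ._≤ _) (sym (ℕ.+-identityʳ _)) (insertDistinct-cost x ys)))
  ... | no  _ | no  _ = s≤s (s≤s (subst (ℕ._≤ _) (sym (ℕ.+-identityʳ _)) (insertDistinct-cost x ys)))

  insertAll-All : ∀ {p} {P : Pred ℝ p} {xs} → All P xs → ∀ {es} → All P es →
                  All P (value (insertAll xs es))
  insertAll-All []         pes = pes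
  insertAll-All (px ∷ pxs) pes = insertAll-All pxs (insertDistinct-All px pes)

  insertAll-Decreasing : ∀ xs {es} → Decreasing es → Decreasing (value (insertAll xs es))
  insertAll-Decreasing []       dec = dec
  insertAll-Decreasing (x ∷ xs) dec = insertAll-Decreasing xs (insertDistinct-Decreasing x dec)

  insertAll-∈ₛ-old : ∀ xs {es z} → z ∈ₛ es → z ∈ₛ value (insertAll xs es)
  insertAll-∈ₛ-old []       z∈ = z∈
  insertAll-∈ₛ-old (x ∷ xs) z∈ = insertAll-∈ₛ-old xs (insertDistinct-∈ₛ-old x z∈)

  insertAll-∈ₛ-new : ∀ {xs es z} → z ∈ xs → z ∈ₛ value (insertAll xs es)
  insertAll-∈ₛ-new {x ∷ xs} {es} (here refl) = insertAll-∈ₛ-old xs (insertDistinct-∈ₛ-new x es)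
  insertAll-∈ₛ-new               (there z∈)  = insertAll-∈ₛ-new z∈

  -- Counting distinct values

  Decreasing-lookup : ∀ {es} → Decreasing es → ∀ i j →
                      List.lookup es i ≈ List.lookup es j → i ≡ j
  Decreasing-lookup (e≻ ∷ dec) zero    zero    _  = refl
  Decreasing-lookup (e≻ ∷ dec) zero    (suc j) eq =
    contradiction (≤-reflexive eq) (All.lookup e≻ (∈-lookup j))
  Decreasing-lookup (e≻ ∷ dec) (suc i) zero    eq =
    contradiction (≤-reflexive (≈-sym eq)) (All.lookup e≻ (∈-lookup i))
  Decreasing-lookup (e≻ ∷ dec) (suc i) (suc j) eq = cong suc (Decreasing-lookup dec i j eq)

  -- Pigeonhole: each position of `es` is sent to the position of a representative in `zs`. Elements
  -- sharing a representative are equal up to `≈`, hence sit at the same position by strict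
  -- decrease.
  Decreasing-length-≤ : ∀ {es zs} → Decreasing es → All (_∈ₛ zs) es → length es ℕ.≤ length zs
  Decreasing-length-≤ {es} {zs} dec es⊆zs = Fin.injective⇒≤ {f = Any.index ∘ ∈zs} λ {i} {j} eq →
    Decreasing-lookup dec i j
      (SetoidMembershipProperties.index-injective setoid (∈zs i) (∈zs j) eq)
    where
    ∈zs : ∀ i → List.lookup es i ∈ₛ zs
    ∈zs i = All.lookup es⊆zs (∈-lookup i)

  -- The fixed list `zs` bounds all intermediate lists at once, since each of them stays strictly
  -- decreasing with members in `zs`.
  insertAll-cost : ∀ {zs xs} → All (_∈ₛ zs) xs → ∀ {es} → All (_∈ₛ zs) es → Decreasing es →
                   cost (insertAll xs es) ℕ.≤ length xs ℕ.* (length zs ℕ.* 2)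
  insertAll-cost []                      es⊆zs dec = z≤n
  insertAll-cost {xs = x ∷ _} (x∈zs ∷ xs⊆zs) {es} es⊆zs dec = ℕ.+-mono-≤
    (ℕ.≤-trans (insertDistinct-cost x es) (ℕ.*-monoˡ-≤ 2 (Decreasing-length-≤ dec es⊆zs)))
    (insertAll-cost xs⊆zs (insertDistinct-All x∈zs es⊆zs) (insertDistinct-Decreasing x dec))

  -- Matrix entries, truncation and the cost of the dynamic program

  entries-All : ∀ {p} {P : Pred ℝ p} {m n} (D : Matrix m n) →
                (∀ i j → P (Vec.lookup (Vec.lookup D i) j)) → All P (entries D)
  entries-All D PD = VecAll.toList⁺ (VecAll.concat⁺ {xss = D} (VecAll.lookup⁻ λ i → VecAll.lookup⁻ (PD i)))

  ∈-entries : ∀ {p q} (D : Matrix (suc p) (suc q)) x → (D ! x) ∈ entries D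
  ∈-entries D (i , j) = VecAny.toList⁺ (VecAny.concat⁺
    (VecAny.map (λ { refl → VecMembership.∈-lookup j (Vec.lookup D i) }) (VecMembership.∈-lookup i D)))

  length-entries : ∀ {m n} (D : Matrix m n) → length (entries D) ≡ m ℕ.* n
  length-entries D = Vec.length-toList (Vec.concat D)

  truncate-! : ∀ {p q} e (D : Matrix (suc p) (suc q)) x →
               value (truncate e D) ! x ≡ excess e (D ! x)
  truncate-! e D (i , j) = trans
    (cong (λ row → Vec.lookup row j) (forEach-lookup D _ i)) (forEach-lookup (Vec.lookup D i) _ j)

  -- One subtraction and one maximum per entry.
  truncate-cost : ∀ {m n} e (D : Matrix m n) → cost (truncate e D) ≡ m ℕ.* (n ℕ.* 2)
  truncate-cost e D = forEach-cost D _ λ row → forEach-cost row _ λ _ → refl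

  -- Identifies the objective of DTW on the truncated matrix with the excess sum in the bounds on
  -- `topSum`.
  traversalSum-truncate : ∀ {p q} e (D : Matrix (suc p) (suc q)) {x} (T : TraversalTo x) →
    traversalSum (value (truncate e D)) T ≡ sum (map (excess e) (map (D !_) (indices T)))
  traversalSum-truncate e D T = cong sum
    (trans (List.map-cong (truncate-! e D) (indices T)) (List.map-∘ (indices T)))

  -- Two minima and one addition per cell.
  dtwRow-cost : ∀ {n} diag left (ups : Vec (ℝ ⁺) n) xs → cost (dtwRow diag left ups xs) ≡ n ℕ.* 3
  dtwRow-cost diag left []         []       = refl
  dtwRow-cost diag left (up ∷ ups) (x ∷ xs) =
    cong (3 ℕ.+_) (trans (ℕ.+-identityʳ _) (dtwRow-cost up _ ups xs))

  dtwRows-cost : ∀ {m n} corner prev (D : Matrix m n) →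
                 cost (dtwRows corner prev D) ≡ m ℕ.* (n ℕ.* 3)
  dtwRows-cost corner prev []       = refl
  dtwRows-cost corner prev (r ∷ rs) =
    cong₂ ℕ._+_ (dtwRow-cost corner ⊤⁺ prev r) (dtwRows-cost ⊤⁺ _ rs)

  dtw-cost : ∀ {p q} (D : Matrix (suc p) (suc q)) → cost (dtw D) ≡ suc p ℕ.* (suc q ℕ.* 3)
  dtw-cost D = trans (ℕ.+-identityʳ _) (dtwRows-cost _ _ D)

  -- The loop over thresholds

  module _ {p q} (k : ℕ) (D : Matrix (suc p) (suc q)) where

    -- The value that the round for `e` compares with the current minimum.
    candidate : ℝ → ℝ ⁺
    candidate e = (k · e) +⁺ value (dtw (value (truncate e D)))

    candidate-spec : ∀ e → ∃ λ r → candidate e ≡ [ k · e + r ] × IsDTW (value (truncate e D)) r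
    candidate-spec e with r , eq , isDTW ← dtw-isDTW (value (truncate e D)) =
      r , cong ((k · e) +⁺_) eq , isDTW

    loop-≤-start : ∀ es m → value (loop k D es m) ≤⁺ m
    loop-≤-start []       m = ≤⁺-refl m
    loop-≤-start (e ∷ es) m =
      ≤⁺-trans ≤-trans (loop-≤-start es _) (proj₁ (min⁺-≤ m (candidate e)))

    loop-≤-candidate : ∀ {es e} m → e ∈ es → value (loop k D es m) ≤⁺ candidate e
    loop-≤-candidate {e ∷ es} m (here refl) =
      ≤⁺-trans ≤-trans (loop-≤-start es _) (proj₂ (min⁺-≤ m (candidate e)))
    loop-≤-candidate m (there e∈) = loop-≤-candidate _ e∈

    loop-sel : ∀ es m → value (loop k D es m) ≡ m ⊎
                        ∃ λ e → e ∈ es × value (loop k D es m) ≡ candidate e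
    loop-sel []       m = inj₁ refl
    loop-sel (e ∷ es) m with loop-sel es (min⁺ m (candidate e))
    ... | inj₂ (f , f∈ , eq) = inj₂ (f , there f∈ , eq)
    ... | inj₁ eq with min⁺-sel m (candidate e)
    ...   | inj₁ eq′ = inj₁ (trans eq eq′)
    ...   | inj₂ eq′ = inj₂ (e , here refl , trans eq eq′)

    -- The summand 3 of a round is the multiplication by `k`, the addition and the update of the
    -- minimum.
    loop-cost : ∀ es m → cost (loop k D es m) ≡
                length es ℕ.* (suc p ℕ.* (suc q ℕ.* 2) ℕ.+ (suc p ℕ.* (suc q ℕ.* 3) ℕ.+ 3))
    loop-cost []       m = refl
    loop-cost (e ∷ es) m
      rewrite truncate-cost e D | dtw-cost (value (truncate e D))
            | loop-cost es (min⁺ m (candidate e)) =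
      solve 3 (λ a b l → a :+ (b :+ (con 3 :+ l)) := a :+ (b :+ con 3) :+ l) refl
        (suc p ℕ.* (suc q ℕ.* 2)) (suc p ℕ.* (suc q ℕ.* 3)) _
      where open +-*-Solver

    -- `lower` chooses for each traversal its own threshold by `topSum-≥`; `attained` takes the
    -- optimal traversal of the winning round. The threshold `0#` serves traversals with fewer than
    -- `k` pairs, and `M` serves `k` equal to 0.
    loop-min : ∀ {es M} → 0# ∈ es → (∀ {e} → e ∈ es → 0# ≤ e) → M ∈ es →
      (∀ x → (D ! x) ≤ M) → (∀ x → ∃ λ e → e ∈ es × e ≈ D ! x) →
      ∃ λ r → value (loop k D es ⊤⁺) ≡ [ r ] ×
              IsMinimum {A = Traversal p q} (λ T → topSum k (map (D !_) (indices T))) r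
    loop-min {es} {M} 0∈es 0≤es M∈es D≤M D∈es = attained (loop-sel es ⊤⁺)
      where
      top : Traversal p q → ℝ
      top T = topSum k (map (D !_) (indices T))

      lower : ∀ {r} → value (loop k D es ⊤⁺) ≡ [ r ] → ∀ T → r ≤ top T
      lower eq T
        with e , e∈es , e≤ ← topSum-≥ 0∈es 0≤es k (map (D !_) (indices T)) M∈es
               (All.map⁺ (All.universal D≤M (indices T))) (All.map⁺ (All.universal D∈es (indices T)))
        with s , cand≡ , _ , s≤ ← candidate-spec e
        with [ r≤ ] ← subst (_ ≤⁺_) cand≡ (subst (_≤⁺ _) eq (loop-≤-candidate ⊤⁺ e∈es)) = begin
          _                                                       ≤⟨ r≤ ⟩
          k · e + s                                               ≤⟨ +-monoʳ-≤ _ (s≤ T) ⟩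
          k · e + traversalSum (value (truncate e D)) T
            ≡⟨ cong (k · e +_) (traversalSum-truncate e D T) ⟩
          k · e + sum (map (excess e) (map (D !_) (indices T)))   ≤⟨ e≤ ⟩
          top T                                                   ∎
        where open PosetReasoning poset

      attained : value (loop k D es ⊤⁺) ≡ ⊤⁺ ⊎ (∃ λ e → e ∈ es × value (loop k D es ⊤⁺) ≡ candidate e) →
                 ∃ λ r → value (loop k D es ⊤⁺) ≡ [ r ] × IsMinimum top r
      -- The initial infinity cannot survive, because the candidate for `0#` is finite and bounds
      -- the result.
      attained (inj₁ eq)
        with s , cand≡ , _ ← candidate-spec 0#
        with () ← subst (_ ≤⁺_) cand≡ (subst (_≤⁺ _) eq (loop-≤-candidate ⊤⁺ 0∈es))
      attained (inj₂ (e , e∈es , eq))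
        with s , cand≡ , (T , T≈s) , _ ← candidate-spec e =
        -- `T≤` uses the winning threshold on `T`; the reverse inequality is the general lower bound
        -- applied to `T`.
        k · e + s , loop≡ , (T , antisym T≤ (lower loop≡ T)) , lower loop≡
        where
        open PosetReasoning poset
        loop≡ : value (loop k D es ⊤⁺) ≡ [ k · e + s ]
        loop≡ = trans eq cand≡
        T≤ : top T ≤ k · e + s
        T≤ = begin
          top T                                                 ≤⟨ topSum-≤ (0≤es e∈es) k _ ⟩
          k · e + sum (map (excess e) (map (D !_) (indices T)))
            ≡⟨ cong (k · e +_) (traversalSum-truncate e D T) ⟨
          k · e + traversalSum (value (truncate e D)) T         ≈⟨ +-congˡ T≈s ⟩
          k · e + s                                             ∎

  -- Correctness on curves

  -- The maximum is the head; the given member ensures that there is one.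
  Decreasing-maximum : ∀ {es x} → Decreasing es → x ∈ₛ es →
                       ∃ λ M → M ∈ es × (∀ {y} → y ∈ₛ es → y ≤ M)
  Decreasing-maximum {M ∷ es} (M≻ ∷ _) _ = M , here refl , λ where
    (here y≈M) → ≤-reflexive y≈M
    (there y∈) → let M≻z , y≈z = All.lookupAny M≻ y∈ in ≤-respˡ-≈ (≈-sym y≈z) (≻⇒≥ M≻z)

  module _ {d p q} (σ : Curve d (suc p)) (τ : Curve d (suc q)) where

    distances : Timed (Matrix (suc p) (suc q))
    distances = forEach (Vec.tabulate σ) λ v → forEach (Vec.tabulate τ) λ w → distᵗ v w

    private
      D : Matrix (suc p) (suc q)
      D = value distances

      E : List ℝ
      E = value (distinctDecreasing D)

    distances-! : ∀ x → (D ! x) ≡ distAt σ τ x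
    distances-! (i , j)
      rewrite forEach-lookup (Vec.tabulate σ) (λ v → forEach (Vec.tabulate τ) λ w → distᵗ v w) i
            | forEach-lookup (Vec.tabulate τ) (distᵗ (Vec.lookup (Vec.tabulate σ) i)) j
            | Vec.lookup∘tabulate σ i | Vec.lookup∘tabulate τ j = refl

    distances-cost : cost distances ≡ suc p ℕ.* (suc q ℕ.* 1)
    distances-cost = forEach-cost (Vec.tabulate σ) _ λ v → forEach-cost (Vec.tabulate τ) _ λ w → refl

    E-Decreasing : Decreasing E
    E-Decreasing = insertAll-Decreasing (entries D) []

    E-All : ∀ {ℓ} {P : Pred ℝ ℓ} → (∀ x → P (distAt σ τ x)) → All P E
    E-All {P = P} Pdist =
      insertAll-All (entries-All D λ i j → subst P (sym (distances-! (i , j))) (Pdist (i , j))) []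

    ∈ₛ-E : ∀ x → (D ! x) ∈ₛ E
    ∈ₛ-E x = insertAll-∈ₛ-new {es = []} (∈-entries D x)

    E∷ʳ0-nonNeg : All (0# ≤_) (E ∷ʳ 0#)
    E∷ʳ0-nonNeg = All.∷ʳ⁺ (E-All λ x → dist-nonNeg (σ (proj₁ x)) (τ (proj₂ x))) ≤-refl

    algorithm-isKDTW : ∀ k → ∃ λ r → value (algorithm σ τ k) ≡ [ r ] × IsKDTW k σ τ r
    algorithm-isKDTW k
      -- `E` is nonempty since it represents the distance of the first two vertices.
      with M , M∈E , ≤M ← Decreasing-maximum E-Decreasing (∈ₛ-E (zero , zero))
      with r , eq , (T , T≈r) , r≤ ← loop-min k D (∈-++⁺ʳ E (here refl)) (All.lookup E∷ʳ0-nonNeg)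
             (∈-++⁺ˡ M∈E) (λ x → ≤M (∈ₛ-E x))
             (λ x → let e , e∈E , x≈e = find (∈ₛ-E x) in
                    e , ∈-++⁺ˡ e∈E , ≈-sym x≈e) =
      r , eq , (T , subst (_≈ r) (top≡ T) T≈r) , λ T → subst (r ≤_) (top≡ T) (r≤ T)
      where
      top≡ : (T : Traversal p q) →
        topSum k (map (D !_) (indices T)) ≡ topSum k (map (distAt σ τ) (indices T))
      top≡ T = cong (topSum k) (List.map-cong distances-! (indices T))

    -- Running time

    private
      -- Its length is `numDistances σ τ` by definition, so it can play the role of `zs` in the
      -- counting lemmas.
      Z : List ℝ
      Z = deduplicate _≟_ (map (distAt σ τ) (cartesianProduct (allFin (suc p)) (allFin (suc q))))

    distAt-∈ₛ : ∀ x → distAt σ τ x ∈ₛ Z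
    distAt-∈ₛ (i , j) = SetoidMembershipProperties.∈-deduplicate⁺ setoid _≟_
      (λ z≈y x≈y → ≈-trans x≈y (≈-sym z≈y))
      (Any.map Eq.reflexive (∈-map⁺ (distAt σ τ) (∈-cartesianProduct⁺ (∈-allFin i) (∈-allFin j))))

    algorithm-cost : ∀ k → cost (algorithm σ τ k) ℕ.≤ 19 ℕ.* (suc p ℕ.* suc q ℕ.* numDistances σ τ)
    algorithm-cost k = begin
      cost distances ℕ.+ (cost (distinctDecreasing D) ℕ.+ cost (loop k D (E ∷ʳ 0#) ⊤⁺))
        ≡⟨ cong₂ (λ a b → a ℕ.+ (cost (distinctDecreasing D) ℕ.+ b))
             distances-cost (loop-cost k D (E ∷ʳ 0#) ⊤⁺) ⟩
      m ℕ.* (n ℕ.* 1) ℕ.+ (cost (distinctDecreasing D) ℕ.+ length (E ∷ʳ 0#) ℕ.* round)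
        ≤⟨ ℕ.+-monoʳ-≤ (m ℕ.* (n ℕ.* 1)) (ℕ.+-mono-≤ sort-cost (ℕ.*-mono-≤ rounds round-cost)) ⟩
      m ℕ.* (n ℕ.* 1) ℕ.+ (m ℕ.* n ℕ.* (z ℕ.* 2) ℕ.+ (z ℕ.+ z) ℕ.* (8 ℕ.* (m ℕ.* n)))
        ≤⟨ ℕ.+-monoˡ-≤ _ mn≤mnz ⟩
      m ℕ.* n ℕ.* z ℕ.+ (m ℕ.* n ℕ.* (z ℕ.* 2) ℕ.+ (z ℕ.+ z) ℕ.* (8 ℕ.* (m ℕ.* n)))
        ≡⟨ solve 2 (λ a z → a :* z :+ (a :* (z :* con 2) :+ (z :+ z) :* (con 8 :* a))
                            := con 19 :* (a :* z)) refl (m ℕ.* n) z ⟩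
      19 ℕ.* (m ℕ.* n ℕ.* z) ∎
      where
      open ℕ.≤-Reasoning
      open +-*-Solver
      m n z round : ℕ
      m = suc p
      n = suc q
      z = numDistances σ τ
      round = m ℕ.* (n ℕ.* 2) ℕ.+ (m ℕ.* (n ℕ.* 3) ℕ.+ 3)
      -- This absorbs into `m * n * z` both the computation of the matrix and the extra round for
      -- the appended `0#`.
      1≤z : 1 ℕ.≤ z
      1≤z = nonEmpty (distAt-∈ₛ (zero , zero))
        where
        nonEmpty : ∀ {x xs} → x ∈ₛ xs → 1 ℕ.≤ length xs
        nonEmpty (here _)  = s≤s z≤n
        nonEmpty (there _) = s≤s z≤n
      mn≤mnz : m ℕ.* (n ℕ.* 1) ℕ.≤ m ℕ.* n ℕ.* z
      mn≤mnz = ℕ.≤-trans (ℕ.≤-reflexive (sym (ℕ.*-assoc m n 1))) (ℕ.*-monoʳ-≤ (m ℕ.* n) 1≤z)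
      sort-cost : cost (distinctDecreasing D) ℕ.≤ m ℕ.* n ℕ.* (z ℕ.* 2)
      sort-cost = subst (λ l → cost (distinctDecreasing D) ℕ.≤ l ℕ.* (z ℕ.* 2)) (length-entries D)
        (insertAll-cost (entries-All D λ i j → subst (_∈ₛ Z) (sym (distances-! (i , j))) (distAt-∈ₛ (i , j)))
          [] [])
      rounds : length (E ∷ʳ 0#) ℕ.≤ z ℕ.+ z
      rounds = ℕ.≤-trans (ℕ.≤-reflexive (List.length-++ E))
        (ℕ.+-mono-≤ (Decreasing-length-≤ E-Decreasing (E-All distAt-∈ₛ)) 1≤z)
      round-cost : round ℕ.≤ 8 ℕ.* (m ℕ.* n)
      round-cost = begin
        m ℕ.* (n ℕ.* 2) ℕ.+ (m ℕ.* (n ℕ.* 3) ℕ.+ 3)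
          -- The three operations outside the matrix are charged to its entries: `1 ≤ m * n`, as
          -- both factors are successors.
          ≤⟨ ℕ.+-monoʳ-≤ (m ℕ.* (n ℕ.* 2)) (ℕ.+-monoʳ-≤ (m ℕ.* (n ℕ.* 3)) (ℕ.*-monoʳ-≤ 3 (s≤s z≤n))) ⟩
        m ℕ.* (n ℕ.* 2) ℕ.+ (m ℕ.* (n ℕ.* 3) ℕ.+ 3 ℕ.* (m ℕ.* n))
          ≡⟨ solve 2 (λ m n → m :* (n :* con 2) :+ (m :* (n :* con 3) :+ con 3 :* (m :* n))
                              := con 8 :* (m :* n)) refl m n ⟩
        8 ℕ.* (m ℕ.* n) ∎

open import Data.Nat.Base using (_*_; _≤_)

theorem3p2 : ∀ {c ℓ₁ ℓ₂} (R : CompleteOrderedField c ℓ₁ ℓ₂) → let open KDTW R in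
    (∀ d p q (σ : Curve d (suc p)) (τ : Curve d (suc q)) (k : ℕ) →
    ∃ λ r → value (algorithm σ τ k) ≡ [ r ] × IsKDTW k σ τ r)
    ×
    (∃ λ C → ∀ d p q (σ : Curve d (suc p)) (τ : Curve d (suc q)) (k : ℕ) →
    cost (algorithm σ τ k) ≤ C * (suc p * suc q * numDistances σ τ))
theorem3p2 R =
  (λ d p q σ τ → Analysis.algorithm-isKDTW R σ τ) ,
  19 , λ d p q σ τ → Analysis.algorithm-cost R σ τ
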